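{- For every $n\in\mathbb{N}$ and every $P:(E,R)\mathsf{itree}$, $\tau^{n+1}P=P$ if and only if $P=\mathsf{div}$. Consequently, for every $P:(E,R)\mathsf{itree}$, if $P$ is divergent then $P=\mathsf{div}$.
   Context: Fix a type $E$ of events. For a type $R$, $(E,R)\mathsf{itree}$ is the codatatype (so elements may be infinite) with constructors $\mathsf{Ret}\,r$ ($r\in R$), $\mathsf{Sil}\,P$ written $\tau P$, and $\mathsf{Vis}\,F$ with $F:E\rightharpoonup(E,R)\mathsf{itree}$ a partial function. $\tau^nP$ denotes $P$ prefixed by $n$ constructors $\mathsf{Sil}$. $\mathsf{div}$ is defined corecursively by $\mathsf{div}=\tau\,\mathsf{div}$. An ITree is stable if it is not of the form $\tau P$. $P$ stabilises if there exist $n$ and a stable $P'$ with $P=\tau^nP'$; $P$ is divergent if it does not stabilise. -}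

module Defs where

-- Coinductive types are unavailable here, so the codatatype (E,R) itree is encoded as its
-- final-coalgebra (M-type) presentation: a tree is a coherent labelling of
-- all finite paths from the root.

open import Data.Nat using (ℕ; zero; suc)
open import Data.List using (List; []; _∷_; _++_)
open import Data.Product using (Σ; _×_; _,_)
open import Relation.Binary.PropositionalEquality using (_≡_; refl)
open import Relation.Nullary using (¬_)

-- A step from a node to one of its children:
-- the unique child of a Sil node, or the child of a Vis node at event e.
data Step (E : Set) : Set where
  tauS : Step E
  evS  : E → Step E

-- The label of the node found at a path ('none' = no node at that path).
data Node (R : Set) : Set where
  none : Node R
  ret  : R → Node R
  sil  : Node R
  vis  : Node R

Path : Set → Set
Path E = List (Step E)

-- Vis: children exactly at
-- the events where the partial function F is defined (arbitrary subset of E).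
Fits : {E R : Set} → Node R → (Step E → Node R) → Set
Fits none    f = ∀ s → f s ≡ none
Fits (ret r) f = ∀ s → f s ≡ none
Fits sil     f = (¬ f tauS ≡ none) × (∀ e → f (evS e) ≡ none)
Fits vis     f = f tauS ≡ none

-- (E,R) itree: Ret r | Sil P | Vis F with F : E ⇀ itree, possibly infinite.
record ITree (E R : Set) : Set where
  field
    lab  : Path E → Node R
    root : ¬ lab [] ≡ none
    coh  : ∀ p → Fits (lab p) (λ s → lab (p ++ s ∷ []))

open ITree public

-- Equality of itrees (equality of the codatatype elements): same labels at
-- every path (the coherence proofs carry no information).
_≈_ : {E R : Set} → ITree E R → ITree E R → Set
P ≈ Q = ∀ p → lab P p ≡ lab Q p

infix 4 _≈_

τ-lab : {E R : Set} → ITree E R → Path E → Node R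
τ-lab P []           = sil
τ-lab P (tauS ∷ p)   = lab P p
τ-lab P (evS e ∷ p)  = none

τ : {E R : Set} → ITree E R → ITree E R
lab  (τ P) = τ-lab P
root (τ P) ()
coh  (τ P) []          = root P , λ e → refl
coh  (τ P) (tauS ∷ p)  = coh P p
coh  (τ P) (evS e ∷ p) = λ s → refl

τ^ : {E R : Set} → ℕ → ITree E R → ITree E R
τ^ zero    P = P
τ^ (suc n) P = τ (τ^ n P)

-- div = τ div : the tree whose only paths are tauS^k, all labelled sil.
div-lab : {E R : Set} → Path E → Node R
div-lab []          = sil
div-lab (tauS ∷ p)  = div-lab p
div-lab (evS e ∷ p) = none

div-coh : {E R : Set} (p : Path E) →
          Fits {E} {R} (div-lab p) (λ s → div-lab (p ++ s ∷ []))
div-coh []          = (λ ()) , λ e → refl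
div-coh (tauS ∷ p)  = div-coh p
div-coh (evS e ∷ p) = λ s → refl

div : {E R : Set} → ITree E R
lab  div = div-lab
root div ()
coh  div = div-coh

Stable : {E R : Set} → ITree E R → Set
Stable {E} {R} P = ¬ (Σ (ITree E R) λ Q → P ≈ τ Q)

Stabilises : {E R : Set} → ITree E R → Set
Stabilises {E} {R} P = Σ ℕ λ n → Σ (ITree E R) λ P′ → Stable P′ × (P ≈ τ^ n P′)

Divergent : {E R : Set} → ITree E R → Set
Divergent P = ¬ Stabilises P

module Submission where

-- If τ^(n+1) P ≈ P, a path that has peeled off all τs of τ^k P
-- and reached P itself can continue in τ^(n+1) P instead; so every path of
-- τ^(k+1) P carries the labels of div.  A divergent tree has root sil (otherwise
-- it is stable, hence stabilises with n = 0), so it is τ of its tail, and the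
-- tail is again divergent.

open import Defs
open import Data.Nat using (ℕ; zero; suc)
open import Data.Product using (_×_; _,_; proj₁; proj₂)
open import Data.List using ([]; _∷_; _++_; [_])
open import Data.List.Properties using (++-assoc; ++-identityʳ)
open import Data.Empty using (⊥-elim)
open import Function.Base using (case_of_)
open import Function.Bundles using (_⇔_; mk⇔)
open import Relation.Nullary using (¬_)
open import Relation.Binary.PropositionalEquality using (_≡_; refl; sym; trans; subst)

module _ {E R : Set} where

  τ-cong : {P Q : ITree E R} → P ≈ Q → τ P ≈ τ Q
  τ-cong h []          = refl
  τ-cong h (tauS ∷ q)  = h q
  τ-cong h (evS e ∷ q) = refl

  τ^-≈div : {P : ITree E R} → P ≈ div → ∀ k → τ^ k P ≈ div
  τ^-≈div h zero    p           = h p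
  τ^-≈div h (suc k) []          = refl
  τ^-≈div h (suc k) (tauS ∷ q)  = τ^-≈div h k q
  τ^-≈div h (suc k) (evS e ∷ q) = refl

  periodic⇒τ^suc-≈div : ∀ n {P : ITree E R} → τ^ (suc n) P ≈ P → ∀ k → τ^ (suc k) P ≈ div
  periodic⇒τ^suc-≈div n h k       []          = refl
  periodic⇒τ^suc-≈div n h k       (evS e ∷ q) = refl
  periodic⇒τ^suc-≈div n h (suc k) (tauS ∷ q)  = periodic⇒τ^suc-≈div n h k q
  periodic⇒τ^suc-≈div n h zero    (tauS ∷ q)  =
    trans (sym (h q)) (periodic⇒τ^suc-≈div n h n q)

  periodic⇔≈div : ∀ n (P : ITree E R) → (τ^ (suc n) P ≈ P) ⇔ (P ≈ div)
  periodic⇔≈div n P = mk⇔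
    (λ h p → trans (sym (h p)) (periodic⇒τ^suc-≈div n h n p))
    (λ h p → trans (τ^-≈div h (suc n) p) (sym (h p)))

  lab-none-++ : (P : ITree E R) (p q : Path E) → lab P p ≡ none → lab P (p ++ q) ≡ none
  lab-none-++ P p []      h = subst (λ x → lab P x ≡ none) (sym (++-identityʳ {A = Step E} p)) h
  lab-none-++ P p (s ∷ q) h =
    subst (λ x → lab P x ≡ none) (++-assoc {A = Step E} p [ s ] q) (lab-none-++ P (p ++ [ s ]) q child-none)
    where
    child-none : lab P (p ++ [ s ]) ≡ none
    child-none = subst (λ x → Fits x (λ s → lab P (p ++ [ s ]))) h (coh P p) s

  ¬Stable⇒root-sil : (P : ITree E R) → ¬ Stable P → lab P [] ≡ sil
  ¬Stable⇒root-sil P ¬stable with lab P [] in eq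
  ... | none  = ⊥-elim (root P eq)
  ... | sil   = refl
  ... | ret r = ⊥-elim (¬stable λ (Q , h) → case trans (sym eq) (h []) of λ ())
  ... | vis   = ⊥-elim (¬stable λ (Q , h) → case trans (sym eq) (h []) of λ ())

  Divergent⇒¬Stable : (P : ITree E R) → Divergent P → ¬ Stable P
  Divergent⇒¬Stable P d stable = d (0 , P , stable , λ p → refl)

  module _ (P : ITree E R) (root-sil : lab P [] ≡ sil) where

    private
      root-fits : Fits sil (λ s → lab P [ s ])
      root-fits = subst (λ x → Fits x (λ s → lab P [ s ])) root-sil (coh P [])

    unτ : ITree E R
    lab  unτ p = lab P (tauS ∷ p)
    root unτ   = proj₁ root-fits
    coh  unτ p = coh P (tauS ∷ p)

    ≈τ-unτ : P ≈ τ unτ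
    ≈τ-unτ []          = root-sil
    ≈τ-unτ (tauS ∷ q)  = refl
    ≈τ-unτ (evS e ∷ q) = lab-none-++ P [ evS e ] q (proj₂ root-fits e)

    Divergent-unτ : Divergent P → Divergent unτ
    Divergent-unτ d (n , P′ , stable , h) =
      d (suc n , P′ , stable , λ p → trans (≈τ-unτ p) (τ-cong h p))

  Divergent⇒root-sil : (P : ITree E R) → Divergent P → lab P [] ≡ sil
  Divergent⇒root-sil P d = ¬Stable⇒root-sil P (Divergent⇒¬Stable P d)

  Divergent⇒≈div : (P : ITree E R) → Divergent P → P ≈ div
  Divergent⇒≈div P d []          = Divergent⇒root-sil P d
  Divergent⇒≈div P d (evS e ∷ q) = ≈τ-unτ P (Divergent⇒root-sil P d) (evS e ∷ q)
  Divergent⇒≈div P d (tauS ∷ q)  =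
    Divergent⇒≈div (unτ P root-sil) (Divergent-unτ P root-sil d) q
    where
    root-sil : lab P [] ≡ sil
    root-sil = Divergent⇒root-sil P d

mainTheorem3 : {E R : Set} →
    ((n : ℕ) (P : ITree E R) → (τ^ (suc n) P ≈ P) ⇔ (P ≈ div))
    × ((P : ITree E R) → Divergent P → P ≈ div)
mainTheorem3 = periodic⇔≈div , Divergent⇒≈div
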